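{- Let $C_n$ be the cycle graph with $n$ vertices, edge-colored with exactly $\ell\geq 2$ colors. Then \[\operatorname{wld}(C_n)=\begin{cases} n-2 & \text{if } \ell=2,\\ n-1 & \text{if } \ell>2.\end{cases}\]
   Context: An edge-colored graph $(G,\gamma)$ is a finite connected graph $G$ with a surjective function $\gamma:E(G)\to\mathcal{C}=\{c_1,\dots,c_\ell\}$ onto a finite set of colors (not necessarily a proper edge-coloring). For each color $c_i$ let $E_i(G)=\{e\in E(G):\gamma(e)=c_i\}$. For $W\subseteq E(G)$, let $G_i^W$ be the graph with vertex set $V(G)$ and edge set $W\cup E_i(G)$. The set $W$ is color-connecting if $G_i^W$ is connected for every color $c_i\in\mathcal{C}$. The wild number $\operatorname{wld}(G)$ is the minimum size of a color-connecting set. -}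

module Defs where

open import Data.Fin using (Fin; zero; suc; toℕ; fromℕ<)
open import Data.Fin.Properties using (_≟_; toℕ<n; toℕ-fromℕ<; toℕ-injective; fromℕ<-toℕ)
open import Data.Fin.Subset using (Subset; _∈_; _∪_; ⊤; ∣_∣)
open import Data.Fin.Subset.Properties using (∈⊤)
open import Data.Nat using (ℕ; zero; suc; _≤_; _<_; z≤n; s≤s; NonZero; >-nonZero)
open import Data.Nat.DivMod using (_mod_; _%_; m%n<n; m<n⇒m%n≡m)
open import Data.Nat.Properties using (<-trans; n<1+n; ≤-trans)
open import Data.Product using (_×_; _,_; ∃-syntax)
open import Data.Sum using (_⊎_; inj₁; inj₂; swap)
open import Data.Vec using (tabulate)
open import Function.Definitions using (Surjective)
open import Relation.Binary.Construct.Closure.ReflexiveTransitive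
  using (Star; ε; _◅_; _◅◅_; reverse)
open import Relation.Binary.PropositionalEquality
  using (_≡_; sym; trans; cong)
open import Relation.Nullary using (does)

-- A finite undirected graph. The order of the two ends of an edge carries no
-- meaning (see Adjacent). Loops and parallel edges are not excluded.
record Graph : Set where
  field
    #V   : ℕ
    #E   : ℕ
    ends : Fin #E → Fin #V × Fin #V

  Vertex : Set
  Vertex = Fin #V

  Edge : Set
  Edge = Fin #E

module _ (G : Graph) where
  open Graph G

  -- Adjacency, walks and connectedness in the spanning subgraph of G with
  -- vertex set V(G) and edge set S.
  Adjacent : Subset #E → Vertex → Vertex → Set
  Adjacent S u v = ∃[ e ] e ∈ S × (ends e ≡ (u , v) ⊎ ends e ≡ (v , u))

  Walk : Subset #E → Vertex → Vertex → Set
  Walk S = Star (Adjacent S)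

  SpanningConnected : Subset #E → Set
  SpanningConnected S = ∀ u v → Walk S u v

  Connected : Set
  Connected = SpanningConnected ⊤

record EdgeColoredGraph : Set where
  field
    graph        : Graph
  open Graph graph public
  field
    connected    : Connected graph
    #colors      : ℕ
    γ            : Edge → Fin #colors
    γ-surjective : Surjective _≡_ _≡_ γ

  Color : Set
  Color = Fin #colors

  colorClass : Color → Subset #E
  colorClass c = tabulate (λ e → does (γ e ≟ c))

  ColorConnecting : Subset #E → Set
  ColorConnecting W = ∀ c → SpanningConnected graph (W ∪ colorClass c)

  -- wld = k as a relation: the least size of a color-connecting set is k.
  IsWildNumber : ℕ → Set
  IsWildNumber k =
    (∃[ W ] ColorConnecting W × ∣ W ∣ ≡ k) ×
    (∀ W → ColorConnecting W → k ≤ ∣ W ∣)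

-- Edge i joins vertex i to vertex i + 1 (mod n).
cycle : (n : ℕ) → 3 ≤ n → Graph
cycle n 3≤n = record
  { #V   = n
  ; #E   = n
  ; ends = λ i → i , suc (toℕ i) mod n
  }
  where instance
    n≢0 : NonZero n
    n≢0 = >-nonZero (≤-trans (s≤s z≤n) 3≤n)

cycle-connected : ∀ n (3≤n : 3 ≤ n) → Connected (cycle n 3≤n)
cycle-connected (suc m) 3≤n u v = reverse flip (fromZero u) ◅◅ fromZero v
  where
  C : Graph
  C = cycle (suc m) 3≤n

  flip : ∀ {x y} → Adjacent C ⊤ x y → Adjacent C ⊤ y x
  flip (e , e∈ , p) = e , e∈ , swap p

  walk : ∀ k (k<n : k < suc m) → Walk C ⊤ zero (fromℕ< k<n)
  walk zero    (s≤s _) = ε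
  walk (suc k) 1+k<n   = walk k k<n ◅◅ (x , ∈⊤ , inj₁ (cong (x ,_) next)) ◅ ε
    where
    k<n : k < suc m
    k<n = <-trans (n<1+n k) 1+k<n

    x : Fin (suc m)
    x = fromℕ< k<n

    next : suc (toℕ x) mod suc m ≡ fromℕ< 1+k<n
    next rewrite toℕ-fromℕ< k<n = toℕ-injective
      (trans (toℕ-fromℕ< (m%n<n (suc k) (suc m)))
        (trans (m<n⇒m%n≡m 1+k<n) (sym (toℕ-fromℕ< 1+k<n))))

  fromZero : ∀ x → Walk C ⊤ zero x
  fromZero x with walk (toℕ x) (toℕ<n x)
  ... | w rewrite fromℕ<-toℕ x (toℕ<n x) = w

coloredCycle : ∀ n → 3 ≤ n → ∀ {ℓ} (γ : Fin n → Fin ℓ) →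
               Surjective _≡_ _≡_ γ → EdgeColoredGraph
coloredCycle n 3≤n {ℓ} γ γ-surjective = record
  { graph        = cycle n 3≤n
  ; connected    = cycle-connected n 3≤n
  ; #colors      = ℓ
  ; γ            = γ
  ; γ-surjective = γ-surjective
  }

{-# OPTIONS --safe #-}

-- A spanning subgraph of a cycle is connected iff it misses at most one edge.
-- So W is color-connecting iff no two distinct edges outside W avoid a common
-- color. For ℓ > 2 any two edges avoid some color, so W misses at most one
-- edge. For ℓ = 2 two edges avoid a common color iff they have the same color,
-- so W misses at most one edge of each color.

module Submission where

open import Defs
open import Data.Empty using (⊥-elim)
open import Data.Fin as Fin using (Fin; zero; suc; toℕ; fromℕ; inject₁)
open import Data.Fin.Induction using (<-weakInduction; >-weakInduction)
open import Data.Fin.Properties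
  using (_≟_; any?; pigeonhole; ¬∀⟶∃¬; suc-injective; toℕ-injective;
         toℕ-fromℕ; toℕ-fromℕ<; toℕ-inject₁; toℕ<n; toℕ≤pred[n]; <⇒≢; <-cmp)
open import Data.Fin.Relation.Unary.Top using (view; ‵fromℕ; ‵inject₁)
open import Data.Fin.Subset
  using (Subset; inside; outside; _∈_; _∉_; _∪_; _-_; ⊤; ∣_∣)
open import Data.Fin.Subset.Properties
  using (∈⊤; ∣⊤∣≡n; x∈p∪q⁺; x∈p∪q⁻; x∈p∧x≢y⇒x∈p-y; x∈p⇒∣p-x∣<∣p∣; drop-there)
open import Data.Nat using (ℕ; zero; suc; _+_; _≤_; _<_; _∸_; s≤s)
open import Data.Nat.DivMod using (_mod_; m%n<n; m<n⇒m%n≡m; n%n≡0)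
open import Data.Nat.Properties
  using (≤-refl; ≤-trans; ≤-pred; ≤-reflexive; ≤-antisym; <-irrefl; <⇒≤; m≤n⇒m≤1+n;
         ≤∧≢⇒<; ≰⇒>; +-comm; +-suc; m≤n+o⇒m∸n≤o; m≤n+m∸n; _≤?_)
open import Data.Product using (Σ; _×_; _,_; ∃-syntax; proj₁; proj₂)
open import Data.Sum using (inj₁; inj₂; [_,_]′; swap)
open import Data.Vec using (_∷_)
open import Data.Vec.Properties using ([]=⇒lookup; lookup⇒[]=; lookup∘tabulate)
open import Function using (_∘_; id)
open import Function.Definitions using (Injective; Surjective)
open import Relation.Binary.Construct.Closure.ReflexiveTransitive
  using (ε; _◅_; _◅◅_; fold; reverse)
open import Relation.Binary.Definitions using (tri<; tri≈; tri>)
open import Relation.Binary.PropositionalEquality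
  using (_≡_; _≢_; refl; sym; trans; cong; subst)
open import Relation.Nullary using (yes; no; ¬_; contradiction)
open import Relation.Nullary.Decidable using (dec-true)
open EdgeColoredGraph using (IsWildNumber)

-- If `f` were onto, pigeonhole would give two distinct values the same chosen preimage. This
-- supplies the color that no edge of a short list has.
avoidedValue : ∀ {k ℓ} → k < ℓ → (f : Fin k → Fin ℓ) →
               ∃[ d ] (∀ i → f i ≢ d)
avoidedValue {k} {ℓ} k<ℓ f = d , λ i fi≡d → d∉f (i , fi≡d)
  where
  notOnto : ¬ (∀ d → ∃[ i ] f i ≡ d)
  notOnto onto with i , j , i<j , eq ← pigeonhole k<ℓ (proj₁ ∘ onto)
    = <⇒≢ i<j (trans (sym (proj₂ (onto i))) (trans (cong f eq) (proj₂ (onto j))))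

  avoided : ∃[ d ] ¬ (∃[ i ] f i ≡ d)
  avoided = ¬∀⟶∃¬ ℓ _ (λ d → any? (λ i → f i ≟ d)) notOnto

  open Σ avoided renaming (proj₁ to d; proj₂ to d∉f)

∣p-x∣≤k : ∀ {n k} (p : Subset n) x → x ∈ p → ∣ p ∣ ≤ suc k → ∣ p - x ∣ ≤ k
∣p-x∣≤k p x x∈p ∣p∣≤1+k =
  ≤-pred (≤-trans (x∈p⇒∣p-x∣<∣p∣ {x = x} {p} x∈p) ∣p∣≤1+k)

nonMembers : ∀ {n k} (p : Subset n) → ∣ p ∣ + k ≤ n →
             ∃[ v ] Injective {A = Fin k} _≡_ _≡_ v × (∀ i → v i ∉ p)
nonMembers {k = zero} p h = (λ ()) , (λ {i} → contradiction i λ ()) , λ ()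
nonMembers {k = suc k} (inside ∷ p) (s≤s h)
  with v , inj , out ← nonMembers p h
  = suc ∘ v , inj ∘ suc-injective , λ i → out i ∘ drop-there
nonMembers {suc n} {suc k} (outside ∷ p) h
  with v , inj , out ← nonMembers p (≤-pred (subst (_≤ suc n) (+-suc ∣ p ∣ k) h))
  = v′ , inj′ , out′
  where
  v′ : Fin (suc k) → Fin (suc n)
  v′ zero    = zero
  v′ (suc i) = suc (v i)

  inj′ : Injective _≡_ _≡_ v′
  inj′ {zero}  {zero}  _  = refl
  inj′ {suc i} {suc j} eq = cong suc (inj (suc-injective eq))

  out′ : ∀ i → v′ i ∉ outside ∷ p
  out′ (suc i) = out i ∘ drop-there

-- If the bound failed, `nonMembers` would list `suc k` distinct elements outside `p`. Both lower
-- bounds on the wild number come from this, with `k` equal to 1 and 2.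
nonMembers-bound : ∀ {n} k (p : Subset n) →
  (∀ v → Injective {A = Fin (suc k)} _≡_ _≡_ v → ¬ (∀ i → v i ∉ p)) →
  n ∸ k ≤ ∣ p ∣
nonMembers-bound {n} k p none with ∣ p ∣ + suc k ≤? n
... | yes h with v , inj , out ← nonMembers p h = ⊥-elim (none v inj out)
... | no  h = m≤n+o⇒m∸n≤o n k
  (≤-pred (≤-trans (≰⇒> h) (≤-reflexive (trans (+-suc ∣ p ∣ k) (cong suc (+-comm ∣ p ∣ k))))))

module _ {m : ℕ} where

  next : Fin (suc m) → Fin (suc m)
  next i = suc (toℕ i) mod suc m

  next-fromℕ : next (fromℕ m) ≡ zero
  next-fromℕ rewrite toℕ-fromℕ m =
    toℕ-injective (trans (toℕ-fromℕ< (m%n<n (suc m) (suc m))) (n%n≡0 (suc m)))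

  next-inject₁ : ∀ j → next (inject₁ j) ≡ suc j
  next-inject₁ j rewrite toℕ-inject₁ j =
    toℕ-injective (trans (toℕ-fromℕ< (m%n<n (suc (toℕ j)) (suc m)))
                         (m<n⇒m%n≡m (s≤s (toℕ<n j))))

  -- The vertices on the arc from e + 1 to f, one of the two arcs that remain
  -- when the edges e and f are removed.
  Arc : Fin (suc m) → Fin (suc m) → Fin (suc m) → Set
  Arc e f v = e Fin.< v × v Fin.≤ f

  -- Going forwards, only edge `f` leaves the arc. The wrap-around at the top vertex does no harm:
  -- there `i ≤ f` forces `i ≡ f`.
  arc-next : ∀ {e f} i → i ≢ f → Arc e f i → Arc e f (next i)
  arc-next {e} {f} i i≢f (e<i , i≤f) with view i
  ... | ‵fromℕ = contradiction
    (toℕ-injective (≤-antisym i≤f (subst (toℕ f ≤_) (sym (toℕ-fromℕ m)) (toℕ≤pred[n] f)))) i≢f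
  ... | ‵inject₁ j rewrite next-inject₁ j | toℕ-inject₁ j =
    m≤n⇒m≤1+n e<i ,
    ≤∧≢⇒< i≤f (i≢f ∘ toℕ-injective ∘ trans (toℕ-inject₁ j))

  -- Going backwards, only edge `e` leaves the arc. The wrap-around edge ends at `zero`, which lies
  -- on no arc.
  arc-prev : ∀ {e f} i → i ≢ e → Arc e f (next i) → Arc e f i
  arc-prev {e} {f} i i≢e arc with view i
  arc-prev i i≢e arc | ‵fromℕ rewrite next-fromℕ with () ← proj₁ arc
  arc-prev i i≢e arc | ‵inject₁ j rewrite next-inject₁ j | toℕ-inject₁ j =
    ≤∧≢⇒< (≤-pred (proj₁ arc)) (λ eq → i≢e (toℕ-injective (trans (toℕ-inject₁ j) (sym eq)))) ,
    <⇒≤ (proj₂ arc)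

module _ {m : ℕ} (3≤n : 3 ≤ suc m) (S : Subset (suc m)) where

  private
    C : Graph
    C = cycle (suc m) 3≤n

  -- No edge of `S` crosses the boundary of the arc, so walks preserve membership in it. Vertex `f`
  -- is on the arc, while membership of `e` would mean `e < e`.
  disconnected-< : ∀ {e f} → e Fin.< f → e ∉ S → f ∉ S → ¬ SpanningConnected C S
  disconnected-< {e} {f} e<f e∉S f∉S conn =
    <-irrefl refl (proj₁ (fold (λ u v → Arc e f u → Arc e f v)
      (λ a k → k ∘ step a) id (conn f e) (e<f , ≤-refl)))
    where
    step : ∀ {u v} → Adjacent C S u v → Arc e f u → Arc e f v
    step (i , i∈S , inj₁ refl) = arc-next i (λ { refl → f∉S i∈S })
    step (i , i∈S , inj₂ refl) = arc-prev i (λ { refl → e∉S i∈S })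

  disconnected : ∀ {e f} → e ≢ f → e ∉ S → f ∉ S → ¬ SpanningConnected C S
  disconnected {e} {f} e≢f e∉S f∉S with <-cmp e f
  ... | tri< e<f _ _ = disconnected-< e<f e∉S f∉S
  ... | tri≈ _ e≡f _ = contradiction e≡f e≢f
  ... | tri> _ _ f<e = disconnected-< f<e f∉S e∉S

  -- The edges before e join 0 to every vertex up to e, and the edges after e
  -- join every vertex beyond e to 0.
  spanningConnected : ∀ e → (∀ i → i ≢ e → i ∈ S) → SpanningConnected C S
  spanningConnected e others u v = reverse flip (fromZero u) ◅◅ fromZero v
    where
    flip : ∀ {x y} → Adjacent C S x y → Adjacent C S y x
    flip (i , i∈S , p) = i , i∈S , swap p

    edge : ∀ i → i ≢ e → ∀ {w} → next i ≡ w → Adjacent C S i w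
    edge i i≢e eq = i , others i i≢e , inj₁ (cong (i ,_) eq)

    upTo : ∀ w → w Fin.≤ e → Walk C S zero w
    upTo = <-weakInduction _ (λ _ → ε) λ j walk j<e →
      walk (≤-trans (≤-reflexive (toℕ-inject₁ j)) (<⇒≤ j<e)) ◅◅
      edge (inject₁ j) (λ { refl → <-irrefl (sym (toℕ-inject₁ j)) j<e }) (next-inject₁ j) ◅ ε

    beyond : ∀ w → e Fin.< w → Walk C S w zero
    beyond = >-weakInduction _
      (λ e<m → edge (fromℕ m) (<⇒≢ e<m ∘ sym) next-fromℕ ◅ ε)
      λ j walk e<j → edge (inject₁ j) (<⇒≢ e<j ∘ sym) (next-inject₁ j) ◅
        walk (m≤n⇒m≤1+n (subst (toℕ e <_) (toℕ-inject₁ j) e<j))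

    fromZero : ∀ w → Walk C S zero w
    fromZero w with toℕ w ≤? toℕ e
    ... | yes w≤e = upTo w w≤e
    ... | no  w≰e = reverse flip (beyond w (≰⇒> w≰e))

module _ (G : EdgeColoredGraph) where
  open EdgeColoredGraph G hiding (IsWildNumber)

  ∈-colorClass⁺ : ∀ {c e} → γ e ≡ c → e ∈ colorClass c
  ∈-colorClass⁺ {c} {e} eq =
    lookup⇒[]= e _ (trans (lookup∘tabulate _ e) (dec-true (γ e ≟ c) eq))

  ∈-colorClass⁻ : ∀ {c e} → e ∈ colorClass c → γ e ≡ c
  ∈-colorClass⁻ {c} {e} e∈
    with γ e ≟ c | trans (sym (lookup∘tabulate _ e)) ([]=⇒lookup e∈)
  ... | yes eq | _  = eq
  ... | no  _  | ()

  -- An upper bound on the size of the witness suffices, since the lower bound applied to `W` itself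
  -- turns it into an equality.
  isWildNumber : ∀ {k} W → ColorConnecting W → ∣ W ∣ ≤ k →
                 (∀ W → ColorConnecting W → k ≤ ∣ W ∣) → IsWildNumber G k
  isWildNumber W cc ∣W∣≤k lower = (W , cc , ≤-antisym ∣W∣≤k (lower W cc)) , lower

module _ {m ℓ : ℕ} (3≤n : 3 ≤ suc m) (γ : Fin (suc m) → Fin ℓ)
         (γ-surjective : Surjective _≡_ _≡_ γ) where

  private
    G : EdgeColoredGraph
    G = coloredCycle (suc m) 3≤n γ γ-surjective

  open EdgeColoredGraph G using (ColorConnecting; colorClass)

  -- In the graph of color `d` both edges are missing, so the cycle is cut twice.
  notColorConnecting : ∀ {W e f} d → e ≢ f → e ∉ W → f ∉ W →
                       γ e ≢ d → γ f ≢ d → ¬ ColorConnecting W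
  notColorConnecting {W} d e≢f e∉W f∉W γe≢d γf≢d cc =
    disconnected 3≤n _ e≢f (avoids e∉W γe≢d) (avoids f∉W γf≢d) (cc d)
    where
    avoids : ∀ {i} → i ∉ W → γ i ≢ d → i ∉ W ∪ colorClass d
    avoids i∉W γi≢d = [ i∉W , γi≢d ∘ ∈-colorClass⁻ G ]′ ∘ x∈p∪q⁻ W _

  wildNumber-many : 2 < ℓ → IsWildNumber G m
  wildNumber-many 2<ℓ = isWildNumber G W cc ∣W∣≤m λ W′ cc′ →
    nonMembers-bound 1 W′ λ v inj out →
      let d , avoids = avoidedValue 2<ℓ (γ ∘ v) in
      notColorConnecting d (λ eq → contradiction (inj eq) λ ())
        (out zero) (out (suc zero)) (avoids zero) (avoids (suc zero)) cc′
    where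
    -- The choice of `zero` is arbitrary: the cycle without any one edge is a spanning path,
    -- connected before a color class is added.
    W : Subset (suc m)
    W = ⊤ - zero

    cc : ColorConnecting W
    cc c = spanningConnected 3≤n _ zero λ i i≢0 →
      x∈p∪q⁺ (inj₁ (x∈p∧x≢y⇒x∈p-y ∈⊤ i≢0))

    ∣W∣≤m : ∣ W ∣ ≤ m
    ∣W∣≤m = ∣p-x∣≤k (⊤ {suc m}) zero ∈⊤ (≤-reflexive (∣⊤∣≡n (suc m)))

module _ {m : ℕ} (3≤n : 3 ≤ suc m) (γ : Fin (suc m) → Fin 2)
         (γ-surjective : Surjective _≡_ _≡_ γ) where

  private
    G : EdgeColoredGraph
    G = coloredCycle (suc m) 3≤n γ γ-surjective

  open EdgeColoredGraph G using (ColorConnecting; colorClass)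

  wildNumber-two : IsWildNumber G (m ∸ 1)
  wildNumber-two = isWildNumber G W cc ∣W∣≤m∸1 λ W′ cc′ →
    nonMembers-bound 2 W′ λ v inj out →
      -- Two of three missing edges share one of the two colors; `d` is the other color.
      let i , j , i<j , same = pigeonhole ≤-refl (γ ∘ v)
          d , avoids = avoidedValue {1} ≤-refl (λ _ → γ (v i))
      in notColorConnecting 3≤n γ γ-surjective d (<⇒≢ i<j ∘ inj) (out i) (out j)
           (avoids zero) (avoids zero ∘ trans same) cc′
    where
    e₀ e₁ : Fin (suc m)
    e₀ = proj₁ (γ-surjective zero)
    e₁ = proj₁ (γ-surjective (suc zero))

    γe₀ : γ e₀ ≡ zero
    γe₀ = proj₂ (γ-surjective zero) refl

    γe₁ : γ e₁ ≡ suc zero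
    γe₁ = proj₂ (γ-surjective (suc zero)) refl

    e₁≢e₀ : e₁ ≢ e₀
    e₁≢e₀ eq with () ← trans (sym γe₁) (trans (cong γ eq) γe₀)

    -- One edge of each color is dropped. Each color class restores its own edge, so only the other
    -- one stays missing.
    W : Subset (suc m)
    W = ⊤ - e₀ - e₁

    member : ∀ i → i ≢ e₀ → i ≢ e₁ → i ∈ W
    member i i≢e₀ i≢e₁ = x∈p∧x≢y⇒x∈p-y (x∈p∧x≢y⇒x∈p-y ∈⊤ i≢e₀) i≢e₁

    covered : ∀ {c e i} → γ e ≡ c → (i ≢ e → i ∈ W) → i ∈ W ∪ colorClass c
    covered {e = e} {i} γe≡c i∈W with i ≟ e
    ... | yes refl = x∈p∪q⁺ (inj₂ (∈-colorClass⁺ G γe≡c))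
    ... | no  i≢e  = x∈p∪q⁺ (inj₁ (i∈W i≢e))

    cc : ColorConnecting W
    cc zero       = spanningConnected 3≤n _ e₁ λ i i≢e₁ →
      covered γe₀ λ i≢e₀ → member i i≢e₀ i≢e₁
    cc (suc zero) = spanningConnected 3≤n _ e₀ λ i i≢e₀ →
      covered γe₁ λ i≢e₁ → member i i≢e₀ i≢e₁

    ∣W∣≤m∸1 : ∣ W ∣ ≤ m ∸ 1
    ∣W∣≤m∸1 = ∣p-x∣≤k (⊤ - e₀) e₁ (x∈p∧x≢y⇒x∈p-y ∈⊤ e₁≢e₀)
      (∣p-x∣≤k (⊤ {suc m}) e₀ ∈⊤
        -- Two deletions call for a bound of the form `suc (suc (m ∸ 1))`; under truncated
        -- subtraction this is at least `suc m` for every `m`.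
        (≤-trans (≤-reflexive (∣⊤∣≡n (suc m))) (s≤s (m≤n+m∸n m 1))))

proposition3p3 : ∀ (n ℓ : ℕ) (3≤n : 3 ≤ n) → 2 ≤ ℓ →
    (γ : Fin n → Fin ℓ) (γ-surjective : Surjective _≡_ _≡_ γ) →
    (ℓ ≡ 2 → IsWildNumber (coloredCycle n 3≤n γ γ-surjective) (n ∸ 2)) ×
    (2 < ℓ → IsWildNumber (coloredCycle n 3≤n γ γ-surjective) (n ∸ 1))
proposition3p3 (suc m) ℓ 3≤n _ γ γ-surjective =
  (λ { refl → wildNumber-two 3≤n γ γ-surjective }) , wildNumber-many 3≤n γ γ-surjective
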